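{- Let $A$ and $B$ be formulas of D'.EAK, and let $A'$ and $B'$ be their respective images under the translation into the language of the Dynamic Calculus given in the context, so that $A'\vdash B'$ is a sequent of type $\mathsf{Fm}$ in the language of the Dynamic Calculus. If $A'\vdash B'$ is derivable in the Dynamic Calculus, then $A\vdash B$ is derivable in D'.EAK.
   Context: Both calculi are taken over the same sets of atomic propositions $p$, agents $\mathtt a$, and (functional) actions $\alpha,\beta$, and on a classical propositional base, i.e. with the Grishin rules. For each agent $\mathtt a$ a binary indistinguishability relation on actions is fixed, written $\alpha\mathtt a\beta$, such that $\{\beta\mid\alpha\mathtt a\beta\}$ is finite for each $\alpha$. Notation: an inference is written "premises / conclusion"; "//" marks a rule applicable in both directions. Hatted symbols are structural connectives, unhatted ones operational connectives, and symbols with a tilde are structural connectives called virtual adjoints. **Propositional base (common to both calculi; $X,Y,Z,W$ formula-type structures, $A,B$ formulas).** *Structural rules.* Cut: $X\vdash A,\ A\vdash Y\ /\ X\vdash Y$; $X\vdash Y\ //\ \mathrm I\vdash Y<X$; $X\vdash Y\ //\ X<Y\vdash\mathrm I$; $X\vdash Y\ //\ \mathrm I\vdash X>Y$; $X\vdash Y\ //\ Y>X\vdash\mathrm I$; $\mathrm I\vdash X\ /\ Y\vdash X$; $X\vdash\mathrm I\ /\ X\vdash Y$; $X\vdash Z\ /\ Y\vdash Z<X$; $X\vdash Z\ /\ X<Z\vdash Y$; $X\vdash Z\ /\ Y\vdash X>Z$; $X\vdash Z\ /\ Z>X\vdash Y$; $X;X\vdash Y\ /\ X\vdash Y$; $Y\vdash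 X;X\ /\ Y\vdash X$; $Y;X\vdash Z\ /\ X;Y\vdash Z$; $Z\vdash X;Y\ /\ Z\vdash Y;X$; $X;(Y;Z)\vdash W\ /\ (X;Y);Z\vdash W$; $W\vdash(Z;Y);X\ /\ W\vdash Z;(Y;X)$. Display postulates: $X;Y\vdash Z\ //\ X\vdash Z<Y$; $Z\vdash X;Y\ //\ Z<Y\vdash X$; $X;Y\vdash Z\ //\ Y\vdash X>Z$; $Z\vdash X;Y\ //\ X>Z\vdash Y$. Grishin rules: $X>(Y;Z)\vdash W\ //\ (X>Y);Z\vdash W$; $W\vdash X>(Y;Z)\ //\ W\vdash(X>Y);Z$. *Operational rules and axioms.* $\bot\vdash\mathrm I$; $\mathrm I\vdash\top$; $X\vdash\mathrm I\ /\ X\vdash\bot$; $\mathrm I\vdash X\ /\ \top\vdash X$; $A;B\vdash Z\ /\ A\wedge B\vdash Z$; $X\vdash A,\ Y\vdash B\ /\ X;Y\vdash A\wedge B$; $A\vdash X,\ B\vdash Y\ /\ A\vee B\vdash X;Y$; $Z\vdash A;B\ /\ Z\vdash A\vee B$; $B\vdash Y,\ X\vdash A\ /\ B\leftarrow A\vdash Y<X$; $Z\vdash B<A\ /\ Z\vdash B\leftarrow A$; $B<A\vdash Z\ /\ B\prec A\vdash Z$; $Y\vdash B,\ A\vdash X\ /\ Y<X\vdash B\prec A$; $X\vdash A,\ B\vdash Y\ /\ A\to B\vdash X>Y$; $Z\vdash A>B\ /\ Z\vdash A\to B$; $A>B\vdash Z\ /\ A\succ B\vdash Z$; $A\vdash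 X,\ Y\vdash B\ /\ X>Y\vdash A\succ B$. **D'.EAK.** Formulas: $A::=p\mid\bot\mid\top\mid A\wedge A\mid A\vee A\mid A\to A\mid A\leftarrow A\mid A\succ A\mid A\prec A\mid\langle\mathtt a\rangle A\mid[\mathtt a]A\mid\langle\alpha\rangle A\mid[\alpha]A\mid1_\alpha$. Structures: $X::=A\mid\mathrm I\mid\Phi_\alpha\mid X;X\mid X>X\mid X<X\mid\{s\}X\mid\{s\}^{\smile}X$, where $s$ ranges over agents and actions. Rules: the propositional base; for every agent or action $s$: display postulates $\{s\}X\vdash Y\ //\ X\vdash\{s\}^{\smile}Y$ and $Y\vdash\{s\}X\ //\ \{s\}^{\smile}Y\vdash X$; for $\bullet$ either $\{s\}$ or $\{s\}^{\smile}$, with $\bullet^{\smile}$ denoting the other one: $\mathrm I\vdash X\ /\ \bullet\mathrm I\vdash X$; $X\vdash\mathrm I\ /\ X\vdash\bullet\mathrm I$; $\bullet Y>\bullet Z\vdash X\ /\ \bullet(Y>Z)\vdash X$; $Y\vdash\bullet X>\bullet Z\ /\ Y\vdash\bullet(X>Z)$; $\bullet X;\bullet Y\vdash Z\ /\ \bullet(X;Y)\vdash Z$; $Z\vdash\bullet Y;\bullet X\ /\ Z\vdash\bullet(Y;X)$; $\bullet(X;\bullet^{\smile}Y)\vdash Z\ /\ (\bullet X);Y\vdash Z$; $X\vdash\bullet(Y;\bullet^{\smile}Z)\ /\ X\vdash(\bullet Y);Z$; operational rules $\{s\}A\vdash X\ /\ \langle s\rangle A\vdash X$; $X\vdash A\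 /\ \{s\}X\vdash\langle s\rangle A$; $A\vdash X\ /\ [s]A\vdash\{s\}X$; $X\vdash\{s\}A\ /\ X\vdash[s]A$. For actions moreover: $\Phi_\alpha\vdash X\ /\ 1_\alpha\vdash X$; axiom $\Phi_\alpha\vdash1_\alpha$; *atom* axioms $\Gamma p\vdash\Delta p$ for $\Gamma,\Delta$ arbitrary finite (possibly empty) sequences of prefixes each of the form $\{\alpha_j\}$ or $\{\alpha_j\}^{\smile}$; *balance* $X\vdash Y\ /\ \{\alpha\}X\vdash\{\alpha\}Y$; *comp* $\{\alpha\}\{\alpha\}^{\smile}X\vdash Y\ /\ \Phi_\alpha;X\vdash Y$ and $X\vdash\{\alpha\}\{\alpha\}^{\smile}Y\ /\ X\vdash\Phi_\alpha>Y$; *reduce* $\Phi_\alpha;\{\alpha\}X\vdash Y\ /\ \{\alpha\}X\vdash Y$ and $Y\vdash\Phi_\alpha>\{\alpha\}X\ /\ Y\vdash\{\alpha\}X$; *swap-in*, for each $\beta$ with $\alpha\mathtt a\beta$: $\{\alpha\}\{\mathtt a\}X\vdash Y\ /\ \Phi_\alpha;\{\mathtt a\}\{\beta\}X\vdash Y$ and $Y\vdash\{\alpha\}\{\mathtt a\}X\ /\ Y\vdash\Phi_\alpha>\{\mathtt a\}\{\beta\}X$; *swap-out*, with one premise for each $\beta$ such that $\alpha\mathtt a\beta$: $(\{\mathtt a\}\{\beta\}X\vdash Y\mid\alpha\mathtt a\beta)\ /\ \{\alpha\}\{\mathtt a\}X\vdash(Y;\cdots;Y)$ and $(Y\vdash\{\mathtt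 a\}\{\beta\}X\mid\alpha\mathtt a\beta)\ /\ (Y;\cdots;Y)\vdash\{\alpha\}\{\mathtt a\}X$, where $(Y;\cdots;Y)$ has $|\{\beta\mid\alpha\mathtt a\beta\}|$ occurrences of $Y$ (and is $\mathrm I$ if this number is $0$). **The Dynamic Calculus.** *Operational terms.* Four pairwise disjoint types: $\mathsf{Fnc}$ consists of the atoms $\alpha$ (the actions); $\mathsf{Ag}$ of the atoms $\mathtt a$; $\mathsf{Act}\ni\gamma::=\mathtt a\blacktriangle_3\alpha\mid\mathtt a\vartriangle_3\alpha$; $\mathsf{Fm}\ni A::= p\mid\bot\mid\top\mid A\wedge A\mid A\vee A\mid A\to A\mid A\leftarrow A\mid A\succ A\mid A\prec A\mid \alpha\,\sharp_0 A\mid\gamma\,\sharp_1 A\mid\mathtt a\,\sharp_2 A$, where $\sharp\in\{\vartriangle,\blacktriangle,\vartriangleright,\blacktriangleright\}$. *Structures.* $\mathsf{FM}\ni X::=A\mid \mathrm I\mid X;X\mid X>X\mid X<X\mid F\,\hat\sharp_0 X\mid\Gamma\,\hat\sharp_1X\mid\mathbf a\,\hat\sharp_2X$ with $\hat\sharp\in\{\hat\vartriangle,\hat\blacktriangle,\hat\vartriangleright,\hat\blacktriangleright\}$; $\mathsf{FNC}\ni F::=\alpha\mid X\tilde\vartriangleleft_0X\mid X\tilde\blacktriangleleft_0X\mid\mathbf a\,\tilde\vartriangleright_3\Gamma\mid\mathbf a\,\tilde\blacktriangleright_3\Gamma$; $\mathsf{ACT}\ni\Gamma::=\gamma\mid\mathbf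 a\,\hat\blacktriangle_3F\mid\mathbf a\,\hat\vartriangle_3F\mid X\hat\vartriangleleft_1X\mid X\hat\blacktriangleleft_1X$; $\mathsf{AG}\ni\mathbf a::=\mathtt a\mid X\tilde\vartriangleleft_2X\mid X\tilde\blacktriangleleft_2X\mid\Gamma\tilde\vartriangleleft_3F\mid\Gamma\tilde\blacktriangleleft_3F$. Below $x,y,z$ are structures and $a,b$ operational terms of the type making the expression well formed. *Rules.* The propositional base, together with: Axioms $\mathtt a\vdash\mathtt a$; $\alpha\vdash\alpha$; *atom*: $F_1\circ_1(F_2\circ_2\cdots(F_n\circ_n p)\cdots)\vdash G_1\rhd_1(G_2\rhd_2\cdots(G_m\rhd_m p)\cdots)$ for $n,m\ge0$, $F_i,G_j\in\mathsf{FNC}$, $\circ_i\in\{\hat\vartriangle_0,\hat\blacktriangle_0\}$, $\rhd_j\in\{\hat\vartriangleright_0,\hat\blacktriangleright_0\}$. Cut rules for each type: $x\vdash a,\ a\vdash y\ /\ x\vdash y$, with $x,a,y$ all of the same type. Operational rules: for $0\le i\le3$, $\sharp\in\{\vartriangle,\blacktriangle\}$: $a\,\hat\sharp_i\,b\vdash z\ /\ a\,\sharp_i\,b\vdash z$; $x\vdash a,\ y\vdash b\ /\ x\,\hat\sharp_i\,y\vdash a\,\sharp_i\,b$. For $0\le i\le2$, $\sharp\in\{\vartriangleright,\blacktriangleright\}$: $x\vdash a,\ B\vdash Y\ /\ a\,\sharp_iB\vdash x\,\hat\sharp_iY$; $Z\vdash a\,\hat\sharp_iB\ /\ Z\vdash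 a\,\sharp_iB$. Display postulates: for $0\le i\le2$: $x\hat\vartriangle_iy\vdash z\ //\ y\vdash x\hat\blacktriangleright_iz$; $x\hat\blacktriangle_iy\vdash z\ //\ y\vdash x\hat\vartriangleright_iz$. For $i=1$: $x\hat\vartriangle_1y\vdash z\ //\ x\vdash z\hat\blacktriangleleft_1y$; $x\hat\blacktriangle_1y\vdash z\ //\ x\vdash z\hat\vartriangleleft_1y$. For $i\in\{0,2,3\}$: $x\hat\vartriangle_iy\vdash z\ //\ x\vdash z\tilde\blacktriangleleft_iy$; $x\hat\blacktriangle_iy\vdash z\ //\ x\vdash z\tilde\vartriangleleft_iy$. For $i=3$: $x\hat\vartriangle_3y\vdash z\ //\ y\vdash x\tilde\blacktriangleright_3z$; $x\hat\blacktriangle_3y\vdash z\ //\ y\vdash x\tilde\vartriangleright_3z$. Necessitation, conjugation, Fischer Servi, monotonicity, for $0\le i\le2$: $\mathrm I\vdash W\ /\ x\hat\vartriangle_i\mathrm I\vdash W$; $\mathrm I\vdash W\ /\ x\hat\blacktriangle_i\mathrm I\vdash W$; $W\vdash\mathrm I\ /\ W\vdash x\hat\vartriangleright_i\mathrm I$; $W\vdash\mathrm I\ /\ W\vdash x\hat\blacktriangleright_i\mathrm I$; $x\hat\vartriangle_i((x\hat\blacktriangle_iY);Z)\vdash W\ /\ Y;(x\hat\vartriangle_iZ)\vdash W$; $x\hat\blacktriangle_i((x\hat\vartriangle_iY);Z)\vdash W\ /\ Y;(x\hat\blacktriangle_iZ)\vdash W$; $W\vdash x\hat\vartriangleright_i((x\hat\blacktriangleright_iY);Z)\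 /\ W\vdash Y;(x\hat\vartriangleright_iZ)$; $W\vdash x\hat\blacktriangleright_i((x\hat\vartriangleright_iY);Z)\ /\ W\vdash Y;(x\hat\blacktriangleright_iZ)$; $(x\hat\vartriangleright_iY)>(x\hat\vartriangle_iZ)\vdash W\ /\ x\hat\vartriangle_i(Y>Z)\vdash W$; $(x\hat\blacktriangleright_iY)>(x\hat\blacktriangle_iZ)\vdash W\ /\ x\hat\blacktriangle_i(Y>Z)\vdash W$; $W\vdash(x\hat\vartriangle_iY)>(x\hat\vartriangleright_iZ)\ /\ W\vdash x\hat\vartriangleright_i(Y>Z)$; $W\vdash(x\hat\blacktriangle_iY)>(x\hat\blacktriangleright_iZ)\ /\ W\vdash x\hat\blacktriangleright_i(Y>Z)$; $(x\hat\vartriangle_iY);(x\hat\vartriangle_iZ)\vdash W\ /\ x\hat\vartriangle_i(Y;Z)\vdash W$; $(x\hat\blacktriangle_iY);(x\hat\blacktriangle_iZ)\vdash W\ /\ x\hat\blacktriangle_i(Y;Z)\vdash W$; $W\vdash(x\hat\vartriangleright_iY);(x\hat\vartriangleright_iZ)\ /\ W\vdash x\hat\vartriangleright_i(Y;Z)$; $W\vdash(x\hat\blacktriangleright_iY);(x\hat\blacktriangleright_iZ)\ /\ W\vdash x\hat\blacktriangleright_i(Y;Z)$. swap-out: $(\mathbf a\hat\blacktriangle_3F)\hat\blacktriangle_1(\mathbf a\hat\blacktriangle_2X)\vdash Y\ /\ \mathbf a\hat\blacktriangle_2(F\hat\blacktriangle_0X)\vdash Y$; $X\vdash(\mathbf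 a\hat\blacktriangle_3F)\hat\blacktriangleright_1(\mathbf a\hat\blacktriangleright_2Y)\ /\ X\vdash\mathbf a\hat\blacktriangleright_2(F\hat\blacktriangleright_0Y)$. swap-in: $\mathbf a\hat\blacktriangle_2(F\hat\blacktriangle_0X)\vdash Y\ /\ (\mathbf a\hat\blacktriangle_3F)\hat\blacktriangle_1(\mathbf a\hat\blacktriangle_2((F\hat\vartriangle_0\mathrm I);X))\vdash Y$; $X\vdash\mathbf a\hat\blacktriangleright_2(F\hat\blacktriangleright_0Y)\ /\ X\vdash(\mathbf a\hat\blacktriangle_3F)\hat\blacktriangleright_1(\mathbf a\hat\blacktriangleright_2((F\hat\vartriangle_0\mathrm I)>Y))$. balance: $X\vdash Y\ /\ F\hat\vartriangle_0X\vdash F\hat\vartriangleright_0Y$, for $F\in\mathsf{FNC}$. **Translation** $A\mapsto A'$ from D'.EAK formulas to terms of type $\mathsf{Fm}$: it is the identity on atomic propositions, commutes with the propositional connectives and constants, and $(\langle\alpha\rangle A)'=\alpha\vartriangle_0A'$, $([\alpha]A)'=\alpha\vartriangleright_0A'$, $(\langle\mathtt a\rangle A)'=\mathtt a\vartriangle_2A'$, $([\mathtt a]A)'=\mathtt a\vartriangleright_2A'$, $(1_\alpha)'=\alpha\vartriangle_0\top$. -}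

module Defs where

open import Data.List using (List; length)
open import Data.List.Membership.Propositional using (_∈_)
open import Data.List.Relation.Unary.Unique.Propositional using (Unique)
open import Data.Nat using (ℕ; zero; suc)
open import Function.Bundles using (_⇔_)

-- The finiteness of { β | α ~[ a ] β } is given by a duplicate-free
-- enumeration, so that its cardinality is the length of the list.
record Language : Set₁ where
  field
    Atom Agent Action : Set
    _~[_]_            : Action → Agent → Action → Set
    image             : Action → Agent → List Action
    image-unique      : ∀ α a → Unique (image α a)
    ∈-image           : ∀ α a β → β ∈ image α a ⇔ α ~[ a ] β

record PropLanguage : Set₁ where
  infix  8 ↑_
  infix  6 _⨟_ _>_ _<_
  infix  6 _∧_ _∨_ _⇒_ _⇐_ _≻_ _≺_
  field
    Formula Structure       : Set
    ⊥ ⊤                     : Formula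
    _∧_ _∨_ _⇒_ _⇐_ _≻_ _≺_ : Formula → Formula → Formula
    ↑_                      : Formula → Structure
    I                       : Structure
    _⨟_ _>_ _<_             : Structure → Structure → Structure

-- The rules of the classical propositional base other than Cut, which each
-- calculus adds for its own types.  An element of Rule _⊢_ X Y is one rule
-- instance with conclusion X ⊢ Y, together with elements of _⊢_ for its
-- premises.  A rule applicable in both directions is a pair of constructors,
-- marked ↓ (top to bottom) and ↑ (bottom to top).
module Propositional (P : PropLanguage) where

  open PropLanguage P

  private variable
    A B     : Formula
    X Y Z W : Structure

  module _ (Derivable : Structure → Structure → Set) where

    private
      infix 4 _⊢_

      _⊢_ : Structure → Structure → Set
      _⊢_ = Derivable

    data Rule : Structure → Structure → Set where
      I<↓  : X ⊢ Y → Rule I (Y < X)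
      I<↑  : I ⊢ Y < X → Rule X Y
      <I↓  : X ⊢ Y → Rule (X < Y) I
      <I↑  : X < Y ⊢ I → Rule X Y
      I>↓  : X ⊢ Y → Rule I (X > Y)
      I>↑  : I ⊢ X > Y → Rule X Y
      >I↓  : X ⊢ Y → Rule (Y > X) I
      >I↑  : Y > X ⊢ I → Rule X Y

      I-weakₗ : I ⊢ X → Rule Y X
      I-weakᵣ : X ⊢ I → Rule X Y
      weak<ᵣ  : X ⊢ Z → Rule Y (Z < X)
      weak<ₗ  : X ⊢ Z → Rule (X < Z) Y
      weak>ᵣ  : X ⊢ Z → Rule Y (X > Z)
      weak>ₗ  : X ⊢ Z → Rule (Z > X) Y
      contrₗ  : X ⨟ X ⊢ Y → Rule X Y
      contrᵣ  : Y ⊢ X ⨟ X → Rule Y X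
      exchₗ   : Y ⨟ X ⊢ Z → Rule (X ⨟ Y) Z
      exchᵣ   : Z ⊢ X ⨟ Y → Rule Z (Y ⨟ X)
      assocₗ  : X ⨟ (Y ⨟ Z) ⊢ W → Rule ((X ⨟ Y) ⨟ Z) W
      assocᵣ  : W ⊢ (Z ⨟ Y) ⨟ X → Rule W (Z ⨟ (Y ⨟ X))

      disp-⨟<↓ : X ⨟ Y ⊢ Z → Rule X (Z < Y)
      disp-⨟<↑ : X ⊢ Z < Y → Rule (X ⨟ Y) Z
      disp-<⨟↓ : Z ⊢ X ⨟ Y → Rule (Z < Y) X
      disp-<⨟↑ : Z < Y ⊢ X → Rule Z (X ⨟ Y)
      disp-⨟>↓ : X ⨟ Y ⊢ Z → Rule Y (X > Z)
      disp-⨟>↑ : Y ⊢ X > Z → Rule (X ⨟ Y) Z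
      disp->⨟↓ : Z ⊢ X ⨟ Y → Rule (X > Z) Y
      disp->⨟↑ : X > Z ⊢ Y → Rule Z (X ⨟ Y)

      grishinₗ↓ : X > (Y ⨟ Z) ⊢ W → Rule ((X > Y) ⨟ Z) W
      grishinₗ↑ : (X > Y) ⨟ Z ⊢ W → Rule (X > (Y ⨟ Z)) W
      grishinᵣ↓ : W ⊢ X > (Y ⨟ Z) → Rule W ((X > Y) ⨟ Z)
      grishinᵣ↑ : W ⊢ (X > Y) ⨟ Z → Rule W (X > (Y ⨟ Z))

      ⊥ₗ : Rule (↑ ⊥) I
      ⊥ᵣ : X ⊢ I → Rule X (↑ ⊥)
      ⊤ₗ : I ⊢ X → Rule (↑ ⊤) X
      ⊤ᵣ : Rule I (↑ ⊤)
      ∧ₗ : ↑ A ⨟ ↑ B ⊢ Z → Rule (↑ (A ∧ B)) Z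
      ∧ᵣ : X ⊢ ↑ A → Y ⊢ ↑ B → Rule (X ⨟ Y) (↑ (A ∧ B))
      ∨ₗ : ↑ A ⊢ X → ↑ B ⊢ Y → Rule (↑ (A ∨ B)) (X ⨟ Y)
      ∨ᵣ : Z ⊢ ↑ A ⨟ ↑ B → Rule Z (↑ (A ∨ B))
      ⇐ₗ : ↑ B ⊢ Y → X ⊢ ↑ A → Rule (↑ (B ⇐ A)) (Y < X)
      ⇐ᵣ : Z ⊢ ↑ B < ↑ A → Rule Z (↑ (B ⇐ A))
      ≺ₗ : ↑ B < ↑ A ⊢ Z → Rule (↑ (B ≺ A)) Z
      ≺ᵣ : Y ⊢ ↑ B → ↑ A ⊢ X → Rule (Y < X) (↑ (B ≺ A))
      ⇒ₗ : X ⊢ ↑ A → ↑ B ⊢ Y → Rule (↑ (A ⇒ B)) (X > Y)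
      ⇒ᵣ : Z ⊢ ↑ A > ↑ B → Rule Z (↑ (A ⇒ B))
      ≻ₗ : ↑ A > ↑ B ⊢ Z → Rule (↑ (A ≻ B)) Z
      ≻ᵣ : ↑ A ⊢ X → Y ⊢ ↑ B → Rule (X > Y) (↑ (A ≻ B))

module Calculi (𝓛 : Language) where

  open Language 𝓛

  -- The calculus D'.EAK.
  module EAK where

    infix  4 _⊢_
    infix  8 ↑_
    infix  6 _⨟_ _>_ _<_
    infix  6 _∧_ _∨_ _⇒_ _⇐_ _≻_ _≺_
    infixr 7 _·_ ⟨_⟩_ [_]_
    infix  9 _˘

    data Label : Set where
      ag  : Agent → Label
      act : Action → Label

    data Formula : Set where
      `_                      : Atom → Formula
      ⊥ ⊤                     : Formula
      _∧_ _∨_ _⇒_ _⇐_ _≻_ _≺_ : Formula → Formula → Formula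
      ⟨_⟩_ [_]_               : Label → Formula → Formula
      𝟏                       : Action → Formula

    -- ⟪ s ⟫ · X and ⟪ s ⟫˘ · X are the structures {s}X and {s}˘X.
    data Prefix : Set where
      ⟪_⟫ ⟪_⟫˘ : Label → Prefix

    _˘ : Prefix → Prefix
    ⟪ s ⟫  ˘ = ⟪ s ⟫˘
    ⟪ s ⟫˘ ˘ = ⟪ s ⟫

    data Structure : Set where
      ↑_          : Formula → Structure
      I           : Structure
      Φ           : Action → Structure
      _⨟_ _>_ _<_ : Structure → Structure → Structure
      _·_         : Prefix → Structure → Structure

    propLanguage : PropLanguage
    propLanguage = record
      { Formula = Formula ; Structure = Structure
      ; ⊥ = ⊥ ; ⊤ = ⊤ ; _∧_ = _∧_ ; _∨_ = _∨_
      ; _⇒_ = _⇒_ ; _⇐_ = _⇐_ ; _≻_ = _≻_ ; _≺_ = _≺_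
      ; ↑_ = ↑_ ; I = I ; _⨟_ = _⨟_ ; _>_ = _>_ ; _<_ = _<_
      }

    -- The structures Γp with Γ a sequence of prefixes {α} and {α}˘.
    data Prefixed (p : Atom) : Structure → Set where
      atom : Prefixed p (↑ (` p))
      fwd  : ∀ α {X} → Prefixed p X → Prefixed p (⟪ act α ⟫ · X)
      bwd  : ∀ α {X} → Prefixed p X → Prefixed p (⟪ act α ⟫˘ · X)

    -- (Y ⨟ ⋯ ⨟ Y) with n occurrences of Y, associated to the right.
    copies : ℕ → Structure → Structure
    copies zero          Y = I
    copies (suc zero)    Y = Y
    copies (suc (suc n)) Y = Y ⨟ copies (suc n) Y

    private variable
      p       : Atom
      a       : Agent
      α β     : Action
      s       : Label
      q       : Prefix
      A B     : Formula
      X Y Z W : Structure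

    data _⊢_ : Structure → Structure → Set where
      prop : Propositional.Rule propLanguage _⊢_ X Y → X ⊢ Y
      cut  : X ⊢ ↑ A → ↑ A ⊢ Y → X ⊢ Y

      dispₗ↓ : ⟪ s ⟫ · X ⊢ Y → X ⊢ ⟪ s ⟫˘ · Y
      dispₗ↑ : X ⊢ ⟪ s ⟫˘ · Y → ⟪ s ⟫ · X ⊢ Y
      dispᵣ↓ : Y ⊢ ⟪ s ⟫ · X → ⟪ s ⟫˘ · Y ⊢ X
      dispᵣ↑ : ⟪ s ⟫˘ · Y ⊢ X → Y ⊢ ⟪ s ⟫ · X

      necₗ  : I ⊢ X → q · I ⊢ X
      necᵣ  : X ⊢ I → X ⊢ q · I
      fsₗ   : (q · Y) > (q · Z) ⊢ X → q · (Y > Z) ⊢ X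
      fsᵣ   : Y ⊢ (q · X) > (q · Z) → Y ⊢ q · (X > Z)
      monₗ  : (q · X) ⨟ (q · Y) ⊢ Z → q · (X ⨟ Y) ⊢ Z
      monᵣ  : Z ⊢ (q · Y) ⨟ (q · X) → Z ⊢ q · (Y ⨟ X)
      conjₗ : q · (X ⨟ (q ˘ · Y)) ⊢ Z → (q · X) ⨟ Y ⊢ Z
      conjᵣ : X ⊢ q · (Y ⨟ (q ˘ · Z)) → X ⊢ (q · Y) ⨟ Z

      ⟨⟩ₗ : ⟪ s ⟫ · ↑ A ⊢ X → ↑ (⟨ s ⟩ A) ⊢ X
      ⟨⟩ᵣ : X ⊢ ↑ A → ⟪ s ⟫ · X ⊢ ↑ (⟨ s ⟩ A)
      []ₗ : ↑ A ⊢ X → ↑ ([ s ] A) ⊢ ⟪ s ⟫ · X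
      []ᵣ : X ⊢ ⟪ s ⟫ · ↑ A → X ⊢ ↑ ([ s ] A)
      𝟏ₗ  : Φ α ⊢ X → ↑ (𝟏 α) ⊢ X
      𝟏ᵣ  : Φ α ⊢ ↑ (𝟏 α)

      atom     : Prefixed p X → Prefixed p Y → X ⊢ Y
      balance  : X ⊢ Y → ⟪ act α ⟫ · X ⊢ ⟪ act α ⟫ · Y
      compₗ    : ⟪ act α ⟫ · ⟪ act α ⟫˘ · X ⊢ Y → Φ α ⨟ X ⊢ Y
      compᵣ    : X ⊢ ⟪ act α ⟫ · ⟪ act α ⟫˘ · Y → X ⊢ Φ α > Y
      reduceₗ  : Φ α ⨟ (⟪ act α ⟫ · X) ⊢ Y → ⟪ act α ⟫ · X ⊢ Y
      reduceᵣ  : Y ⊢ Φ α > (⟪ act α ⟫ · X) → Y ⊢ ⟪ act α ⟫ · X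
      swapInₗ  : α ~[ a ] β →
                 ⟪ act α ⟫ · ⟪ ag a ⟫ · X ⊢ Y →
                 Φ α ⨟ (⟪ ag a ⟫ · ⟪ act β ⟫ · X) ⊢ Y
      swapInᵣ  : α ~[ a ] β →
                 Y ⊢ ⟪ act α ⟫ · ⟪ ag a ⟫ · X →
                 Y ⊢ Φ α > (⟪ ag a ⟫ · ⟪ act β ⟫ · X)
      swapOutₗ : (∀ β → α ~[ a ] β → ⟪ ag a ⟫ · ⟪ act β ⟫ · X ⊢ Y) →
                 ⟪ act α ⟫ · ⟪ ag a ⟫ · X ⊢ copies (length (image α a)) Y
      swapOutᵣ : (∀ β → α ~[ a ] β → Y ⊢ ⟪ ag a ⟫ · ⟪ act β ⟫ · X) →
                 copies (length (image α a)) Y ⊢ ⟪ act α ⟫ · ⟪ ag a ⟫ · X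

  -- The Dynamic Calculus.
  module DC where

    infix  4 _⊢_
    infix  8 ↑_
    infix  6 _⨟_ _>_ _<_
    infix  6 _∧_ _∨_ _⇒_ _⇐_ _≻_ _≺_
    infix  7 _△[_]_ _▲[_]_ _▷[_]_ _▶[_]_
    infix  7 _△̂[_]_ _▲̂[_]_ _▷̂[_]_ _▶̂[_]_ _◁̂[_]_ _◀̂[_]_

    data Type : Set where
      FNC AG ACT FM : Type

    private variable
      t l r o : Type

    -- The subscripts 0, …, 3 of the connectives: at a subscript of type
    -- Index l r o, the connectives △ and ▲ take arguments of types l and r
    -- to a result of type o.  The subscripts 0 ≤ i ≤ 2 are exactly those of
    -- type Index l FM FM for some l.
    data Index : Type → Type → Type → Set where
      i₀ : Index FNC FM  FM
      i₁ : Index ACT FM  FM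
      i₂ : Index AG  FM  FM
      i₃ : Index AG  FNC ACT

    data Term : Type → Set where
      act                     : Action → Term FNC
      ag                      : Agent → Term AG
      `_                      : Atom → Term FM
      ⊥ ⊤                     : Term FM
      _∧_ _∨_ _⇒_ _⇐_ _≻_ _≺_ : Term FM → Term FM → Term FM
      _△[_]_ _▲[_]_           : Term l → Index l r o → Term r → Term o
      _▷[_]_ _▶[_]_           : Term l → Index l FM FM → Term FM → Term FM

    -- The structural ▷ and ▶ at i₃ and the structural ◁ and ◀ at i₀, i₂ and
    -- i₃ are the virtual adjoints, customarily written with a tilde in place
    -- of the hat.
    data Structure : Type → Set where
      ↑_              : Term t → Structure t
      I               : Structure FM
      _⨟_ _>_ _<_     : Structure FM → Structure FM → Structure FM
      _△̂[_]_ _▲̂[_]_ : Structure l → Index l r o → Structure r → Structure o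
      _▷̂[_]_ _▶̂[_]_ : Structure l → Index l r o → Structure o → Structure r
      _◁̂[_]_ _◀̂[_]_ : Structure o → Index l r o → Structure r → Structure l

    propLanguage : PropLanguage
    propLanguage = record
      { Formula = Term FM ; Structure = Structure FM
      ; ⊥ = ⊥ ; ⊤ = ⊤ ; _∧_ = _∧_ ; _∨_ = _∨_
      ; _⇒_ = _⇒_ ; _⇐_ = _⇐_ ; _≻_ = _≻_ ; _≺_ = _≺_
      ; ↑_ = ↑_ ; I = I ; _⨟_ = _⨟_ ; _>_ = _>_ ; _<_ = _<_
      }

    -- The structures F₁ ∘₁ (F₂ ∘₂ ⋯ (Fₙ ∘ₙ p)) with each ∘ᵢ one of △̂₀, ▲̂₀.
    data Prefixedₗ (p : Atom) : Structure FM → Set where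
      atom : Prefixedₗ p (↑ (` p))
      △₀   : ∀ F {X} → Prefixedₗ p X → Prefixedₗ p (F △̂[ i₀ ] X)
      ▲₀   : ∀ F {X} → Prefixedₗ p X → Prefixedₗ p (F ▲̂[ i₀ ] X)

    -- The same for ▷̂₀ and ▶̂₀.
    data Prefixedᵣ (p : Atom) : Structure FM → Set where
      atom : Prefixedᵣ p (↑ (` p))
      ▷₀   : ∀ F {X} → Prefixedᵣ p X → Prefixedᵣ p (F ▷̂[ i₀ ] X)
      ▶₀   : ∀ F {X} → Prefixedᵣ p X → Prefixedᵣ p (F ▶̂[ i₀ ] X)

    private variable
      p       : Atom
      i       : Index l FM FM
      j       : Index l r o
      c d     : Term t
      B       : Term FM
      x y z   : Structure t
      X Y Z W : Structure FM
      𝐚       : Structure AG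
      F       : Structure FNC

    data _⊢_ : Structure t → Structure t → Set where
      prop : Propositional.Rule propLanguage _⊢_ X Y → X ⊢ Y
      cut  : x ⊢ ↑ c → ↑ c ⊢ y → x ⊢ y

      ag   : ∀ a → ↑ ag a ⊢ ↑ ag a
      act  : ∀ α → ↑ act α ⊢ ↑ act α
      atom : Prefixedₗ p X → Prefixedᵣ p Y → X ⊢ Y

      △ₗ : ↑ c △̂[ j ] ↑ d ⊢ z → ↑ (c △[ j ] d) ⊢ z
      △ᵣ : x ⊢ ↑ c → y ⊢ ↑ d → x △̂[ j ] y ⊢ ↑ (c △[ j ] d)
      ▲ₗ : ↑ c ▲̂[ j ] ↑ d ⊢ z → ↑ (c ▲[ j ] d) ⊢ z
      ▲ᵣ : x ⊢ ↑ c → y ⊢ ↑ d → x ▲̂[ j ] y ⊢ ↑ (c ▲[ j ] d)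
      ▷ₗ : x ⊢ ↑ c → ↑ B ⊢ Y → ↑ (c ▷[ i ] B) ⊢ x ▷̂[ i ] Y
      ▷ᵣ : Z ⊢ ↑ c ▷̂[ i ] ↑ B → Z ⊢ ↑ (c ▷[ i ] B)
      ▶ₗ : x ⊢ ↑ c → ↑ B ⊢ Y → ↑ (c ▶[ i ] B) ⊢ x ▶̂[ i ] Y
      ▶ᵣ : Z ⊢ ↑ c ▶̂[ i ] ↑ B → Z ⊢ ↑ (c ▶[ i ] B)

      disp-△▶↓ : x △̂[ j ] y ⊢ z → y ⊢ x ▶̂[ j ] z
      disp-△▶↑ : y ⊢ x ▶̂[ j ] z → x △̂[ j ] y ⊢ z
      disp-▲▷↓ : x ▲̂[ j ] y ⊢ z → y ⊢ x ▷̂[ j ] z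
      disp-▲▷↑ : y ⊢ x ▷̂[ j ] z → x ▲̂[ j ] y ⊢ z
      disp-△◀↓ : x △̂[ j ] y ⊢ z → x ⊢ z ◀̂[ j ] y
      disp-△◀↑ : x ⊢ z ◀̂[ j ] y → x △̂[ j ] y ⊢ z
      disp-▲◁↓ : x ▲̂[ j ] y ⊢ z → x ⊢ z ◁̂[ j ] y
      disp-▲◁↑ : x ⊢ z ◁̂[ j ] y → x ▲̂[ j ] y ⊢ z

      nec-△ : I ⊢ W → x △̂[ i ] I ⊢ W
      nec-▲ : I ⊢ W → x ▲̂[ i ] I ⊢ W
      nec-▷ : W ⊢ I → W ⊢ x ▷̂[ i ] I
      nec-▶ : W ⊢ I → W ⊢ x ▶̂[ i ] I

      conj-△ : x △̂[ i ] ((x ▲̂[ i ] Y) ⨟ Z) ⊢ W → Y ⨟ (x △̂[ i ] Z) ⊢ W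
      conj-▲ : x ▲̂[ i ] ((x △̂[ i ] Y) ⨟ Z) ⊢ W → Y ⨟ (x ▲̂[ i ] Z) ⊢ W
      conj-▷ : W ⊢ x ▷̂[ i ] ((x ▶̂[ i ] Y) ⨟ Z) → W ⊢ Y ⨟ (x ▷̂[ i ] Z)
      conj-▶ : W ⊢ x ▶̂[ i ] ((x ▷̂[ i ] Y) ⨟ Z) → W ⊢ Y ⨟ (x ▶̂[ i ] Z)

      fs-△ : (x ▷̂[ i ] Y) > (x △̂[ i ] Z) ⊢ W → x △̂[ i ] (Y > Z) ⊢ W
      fs-▲ : (x ▶̂[ i ] Y) > (x ▲̂[ i ] Z) ⊢ W → x ▲̂[ i ] (Y > Z) ⊢ W
      fs-▷ : W ⊢ (x △̂[ i ] Y) > (x ▷̂[ i ] Z) → W ⊢ x ▷̂[ i ] (Y > Z)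
      fs-▶ : W ⊢ (x ▲̂[ i ] Y) > (x ▶̂[ i ] Z) → W ⊢ x ▶̂[ i ] (Y > Z)

      mon-△ : (x △̂[ i ] Y) ⨟ (x △̂[ i ] Z) ⊢ W → x △̂[ i ] (Y ⨟ Z) ⊢ W
      mon-▲ : (x ▲̂[ i ] Y) ⨟ (x ▲̂[ i ] Z) ⊢ W → x ▲̂[ i ] (Y ⨟ Z) ⊢ W
      mon-▷ : W ⊢ (x ▷̂[ i ] Y) ⨟ (x ▷̂[ i ] Z) → W ⊢ x ▷̂[ i ] (Y ⨟ Z)
      mon-▶ : W ⊢ (x ▶̂[ i ] Y) ⨟ (x ▶̂[ i ] Z) → W ⊢ x ▶̂[ i ] (Y ⨟ Z)

      swapOutₗ : (𝐚 ▲̂[ i₃ ] F) ▲̂[ i₁ ] (𝐚 ▲̂[ i₂ ] X) ⊢ Y →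
                 𝐚 ▲̂[ i₂ ] (F ▲̂[ i₀ ] X) ⊢ Y
      swapOutᵣ : X ⊢ (𝐚 ▲̂[ i₃ ] F) ▶̂[ i₁ ] (𝐚 ▶̂[ i₂ ] Y) →
                 X ⊢ 𝐚 ▶̂[ i₂ ] (F ▶̂[ i₀ ] Y)
      swapInₗ  : 𝐚 ▲̂[ i₂ ] (F ▲̂[ i₀ ] X) ⊢ Y →
                 (𝐚 ▲̂[ i₃ ] F) ▲̂[ i₁ ] (𝐚 ▲̂[ i₂ ] ((F △̂[ i₀ ] I) ⨟ X)) ⊢ Y
      swapInᵣ  : X ⊢ 𝐚 ▶̂[ i₂ ] (F ▶̂[ i₀ ] Y) →
                 X ⊢ (𝐚 ▲̂[ i₃ ] F) ▶̂[ i₁ ] (𝐚 ▶̂[ i₂ ] ((F △̂[ i₀ ] I) > Y))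
      balance  : X ⊢ Y → F △̂[ i₀ ] X ⊢ F ▷̂[ i₀ ] Y

  infix 9 _′

  _′ : EAK.Formula → DC.Term DC.FM
  (EAK.` p) ′              = DC.` p
  EAK.⊥ ′                  = DC.⊥
  EAK.⊤ ′                  = DC.⊤
  (A EAK.∧ B) ′            = A ′ DC.∧ B ′
  (A EAK.∨ B) ′            = A ′ DC.∨ B ′
  (A EAK.⇒ B) ′            = A ′ DC.⇒ B ′
  (A EAK.⇐ B) ′            = A ′ DC.⇐ B ′
  (A EAK.≻ B) ′            = A ′ DC.≻ B ′
  (A EAK.≺ B) ′            = A ′ DC.≺ B ′
  (EAK.⟨ EAK.act α ⟩ A) ′  = DC.act α DC.△[ DC.i₀ ] A ′
  (EAK.[ EAK.act α ] A) ′  = DC.act α DC.▷[ DC.i₀ ] A ′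
  (EAK.⟨ EAK.ag a ⟩ A) ′   = DC.ag a DC.△[ DC.i₂ ] A ′
  (EAK.[ EAK.ag a ] A) ′   = DC.ag a DC.▷[ DC.i₂ ] A ′
  (EAK.𝟏 α) ′              = DC.act α DC.△[ DC.i₀ ] DC.⊤

{-# OPTIONS --safe #-}

-- Every Dynamic Calculus sequent is interpreted in the polarity formed by the
-- structures of D'.EAK and its derivability relation, in the style of Okada's
-- semantic proofs of cut elimination.  A left structure denotes a set of left
-- generators, a right structure a set of right generators, and a formula a
-- Galois-closed set.  The converse modalities, which D'.EAK has only as
-- structural connectives, exist on closed sets because they are residuated.
-- The action a ▲₃ α denotes the set of all β with α ~[ a ] β.  Functions and
-- agents denote sets with at most one element: a virtual adjoint in antecedent
-- position can never be removed again, so it may denote the empty set, and this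
-- is what makes balance sound for arbitrary F.  Finally, A belongs to both the
-- left and the right part of the denotation of A′.

module Submission where

open import Data.Nat using (zero; suc)
open import Level using (0ℓ)
open import Relation.Binary.PropositionalEquality using (_≡_; refl)
open import Relation.Unary using (Pred; _⊆_; ∅)

open import Defs
open Propositional

module Semantics (𝓛 : Language) where

  open Language 𝓛 using (Agent; Action; _~[_]_)
  open Calculi 𝓛
  open EAK
  open DC hiding (propLanguage) renaming (Structure to Structureᴰ; _⊢_ to _⊢ᴰ_)

  private variable
    t l r o : Type
    α       : Action
    X Y Z W : Structure

  -- Derived rules of D'.EAK.

  disp↓ : ∀ q → q · X ⊢ Y → X ⊢ q ˘ · Y
  disp↓ ⟪ _ ⟫  = dispₗ↓
  disp↓ ⟪ _ ⟫˘ = dispᵣ↑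

  disp↑ : ∀ q → X ⊢ q ˘ · Y → q · X ⊢ Y
  disp↑ ⟪ _ ⟫  = dispₗ↑
  disp↑ ⟪ _ ⟫˘ = dispᵣ↓

  codisp↑ : ∀ q → X ⊢ q · Y → q ˘ · X ⊢ Y
  codisp↑ ⟪ _ ⟫  = dispᵣ↓
  codisp↑ ⟪ _ ⟫˘ = dispₗ↑

  codisp↓ : ∀ q → q ˘ · X ⊢ Y → X ⊢ q · Y
  codisp↓ ⟪ _ ⟫  = dispᵣ↑
  codisp↓ ⟪ _ ⟫˘ = dispₗ↓

  weakₗ : X ⊢ Z → X ⨟ Y ⊢ Z
  weakₗ d = prop (disp-⨟>↑ (prop (weak>ᵣ d)))

  I-unitᵣ : X ⨟ I ⊢ Y → X ⊢ Y
  I-unitᵣ d = prop (I>↑ (prop (disp-⨟>↓ d)))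

  contr-copiesₗ : ∀ n → copies n X ⊢ Y → X ⊢ Y
  contr-copiesₗ zero          d = prop (I-weakₗ d)
  contr-copiesₗ (suc zero)    d = d
  contr-copiesₗ (suc (suc n)) d =
    prop (contrₗ (prop (disp-⨟>↑ (contr-copiesₗ (suc n) (prop (disp-⨟>↓ d))))))

  contr-copiesᵣ : ∀ n → Y ⊢ copies n X → Y ⊢ X
  contr-copiesᵣ zero          d = prop (I-weakᵣ d)
  contr-copiesᵣ (suc zero)    d = d
  contr-copiesᵣ (suc (suc n)) d =
    prop (contrᵣ (prop (disp->⨟↑ (contr-copiesᵣ (suc n) (prop (disp->⨟↓ d))))))

  -- Necessitation under `⟪ act α ⟫` gives the antecedent `⟪ act α ⟫ · ⟪ act α ⟫˘ · I`, which comp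
  -- turns into `Φ α ⨟ I`. With `dom⇒Φ`, this lets `𝟏 α` and its translation match.
  Φ⇒dom : ⟪ act α ⟫ · I ⊢ Y → Φ α ⊢ Y
  Φ⇒dom d = I-unitᵣ (compₗ (dispₗ↑ (necₗ (dispₗ↓ d))))

  dom⇒Φ : Φ α ⊢ Y → ⟪ act α ⟫ · X ⊢ Y
  dom⇒Φ d = reduceₗ (weakₗ d)

  -- The two calculi state conjugation with the sides of `⨟` interchanged. Exchange acts only at the
  -- top of a sequent, so `q` is displayed away first.
  conj-exchₗ : ∀ q → q · ((q ˘ · Y) ⨟ Z) ⊢ W → Y ⨟ (q · Z) ⊢ W
  conj-exchₗ q d = prop (exchₗ (conjₗ (disp↑ q (prop (exchₗ (disp↓ q d))))))

  conj-exchᵣ : ∀ q → W ⊢ q · ((q ˘ · Y) ⨟ Z) → W ⊢ Y ⨟ (q · Z)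
  conj-exchᵣ q d = prop (exchᵣ (conjᵣ (codisp↓ q (prop (exchᵣ (codisp↑ q d))))))

  -- The polarity of derivability and its closed sets.

  Carrier : Type → Set
  Carrier FNC = Action
  Carrier AG  = Agent
  Carrier ACT = Action
  Carrier FM  = Structure

  Upper Lower : Pred Structure 0ℓ → Pred Structure 0ℓ
  Upper P Y = ∀ {X} → P X → X ⊢ Y
  Lower Q X = ∀ {Y} → Q Y → X ⊢ Y

  -- Right structures of type FM denote sets of right generators, those of the
  -- other types denote the set of all elements below them.
  Above Below : ∀ t → Pred (Carrier t) 0ℓ → Pred (Carrier t) 0ℓ
  Above FM  P = Upper P
  Above FNC P = P
  Above AG  P = P
  Above ACT P = P
  Below FM  Q = Lower Q
  Below FNC Q = Q
  Below AG  Q = Q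
  Below ACT Q = Q

  Closure : ∀ t → Pred (Carrier t) 0ℓ → Pred (Carrier t) 0ℓ
  Closure t P = Below t (Above t P)

  ⊆-closure : ∀ t (P : Pred (Carrier t) 0ℓ) → P ⊆ Closure t P
  ⊆-closure FM  P p y = y p
  ⊆-closure FNC P p   = p
  ⊆-closure AG  P p   = p
  ⊆-closure ACT P p   = p

  closure-least : ∀ t (P Q : Pred (Carrier t) 0ℓ) →
                  P ⊆ Below t Q → Closure t P ⊆ Below t Q
  closure-least FM  P Q h x y = x (λ p → h p y)
  closure-least FNC P Q h     = h
  closure-least AG  P Q h     = h
  closure-least ACT P Q h     = h

  -- Images, modalities and their adjoints.

  data Image {A B C : Set} (R : A → B → Pred C 0ℓ)
             (P : Pred A 0ℓ) (Q : Pred B 0ℓ) : Pred C 0ℓ where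
    img : ∀ {a b c} → P a → Q b → R a b c → Image R P Q c

  Image₂ : (Structure → Structure → Structure) →
           Pred Structure 0ℓ → Pred Structure 0ℓ → Pred Structure 0ℓ
  Image₂ _∙_ = Image (λ X Y Z → Z ≡ X ∙ Y)

  label : Index l FM FM → Carrier l → Label
  label i₀ = act
  label i₁ = act
  label i₂ = ag

  -- No rule constrains △₃, so it may be interpreted like ▲₃.
  data Rel (q : Label → Prefix) :
       Index l r o → Carrier l → Carrier r → Carrier o → Set where
    modal : (i : Index l FM FM) {c : Carrier l} →
            Rel q i c X (q (label i c) · X)
    step  : ∀ {α a β} → α ~[ a ] β → Rel q i₃ a α β

  Dia : (Label → Prefix) → Index l r o →
        Pred (Carrier l) 0ℓ → Pred (Carrier r) 0ℓ → Pred (Carrier o) 0ℓ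
  Dia q j = Image (Rel q j)

  -- The right adjoints of Dia q j in its second and in its first argument.
  Box : (Label → Prefix) → Index l r o →
        Pred (Carrier l) 0ℓ → Pred (Carrier o) 0ℓ → Pred (Carrier r) 0ℓ
  Box {r = FM} {o = FM} q j P Q = Image (Rel (λ s → q s ˘) j) P Q
  Box {o = o} q j P Q d = ∀ {c e} → P c → Rel q j c d e → Below o Q e

  Residual : (Label → Prefix) → Index l r o →
             Pred (Carrier o) 0ℓ → Pred (Carrier r) 0ℓ → Pred (Carrier l) 0ℓ
  Residual {o = o} q j Q P c = ∀ {d e} → P d → Rel q j c d e → Below o Q e

  -- Denotations of terms and structures.

  mutual

    left right : Term t → Pred (Carrier t) 0ℓ
    left  {t} c = Closure t (generators c)
    right {t} c = Above t (generators c)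

    generators : Term t → Pred (Carrier t) 0ℓ
    generators (act α)      = _≡ α
    generators (ag a)       = _≡ a
    -- Testing against every prefixed form of `p`, and not against `p` alone, is what validates the
    -- atom axioms.
    generators (` p)        = Lower (Prefixed p)
    generators ⊥            = Lower (_≡ I)
    generators ⊤            = _≡ I
    generators (A ∧ B)      = Image₂ _⨟_ (left A) (left B)
    generators (A ∨ B)      = Lower (Image₂ _⨟_ (right A) (right B))
    generators (A ⇒ B)      = Lower (Image₂ _>_ (left A) (right B))
    generators (B ⇐ A)      = Lower (Image₂ _<_ (right B) (left A))
    generators (A ≻ B)      = Image₂ _>_ (right A) (left B)
    generators (B ≺ A)      = Image₂ _<_ (left B) (right A)
    generators (c △[ j ] d) = Dia ⟪_⟫ j (left c) (left d)
    generators (c ▲[ j ] d) = Dia ⟪_⟫˘ j (left c) (left d)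
    -- `▷` is right adjoint to `▲`, whose prefix is `⟪_⟫˘`; `Box` takes the converse once more, so
    -- the right generators are `⟪ s ⟫ · Y`.
    generators (c ▷[ i ] B) = Lower (Box ⟪_⟫˘ i (left c) (right B))
    generators (c ▶[ i ] B) = Lower (Box ⟪_⟫ i (left c) (right B))

  -- A connective in a position where no rule can display its arguments denotes
  -- the empty set of generators, which makes the sequent valid.
  mutual

    ⟦_⟧ₗ : Structureᴰ t → Pred (Carrier t) 0ℓ
    ⟦ ↑ c ⟧ₗ        = left c
    ⟦ I ⟧ₗ          = _≡ I
    ⟦ X ⨟ Y ⟧ₗ      = Image₂ _⨟_ ⟦ X ⟧ₗ ⟦ Y ⟧ₗ
    ⟦ X > Y ⟧ₗ      = Image₂ _>_ ⟦ X ⟧ᵣ ⟦ Y ⟧ₗ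
    ⟦ X < Y ⟧ₗ      = Image₂ _<_ ⟦ X ⟧ₗ ⟦ Y ⟧ᵣ
    ⟦ x △̂[ j ] y ⟧ₗ = Dia ⟪_⟫ j ⟦ x ⟧ₗ ⟦ y ⟧ₗ
    ⟦ x ▲̂[ j ] y ⟧ₗ = Dia ⟪_⟫˘ j ⟦ x ⟧ₗ ⟦ y ⟧ₗ
    ⟦ x ▷̂[ j ] y ⟧ₗ = ∅
    ⟦ x ▶̂[ j ] y ⟧ₗ = ∅
    ⟦ x ◁̂[ j ] y ⟧ₗ = ∅
    ⟦ x ◀̂[ j ] y ⟧ₗ = ∅

    ⟦_⟧ᵣ : Structureᴰ t → Pred (Carrier t) 0ℓ
    ⟦ ↑ c ⟧ᵣ        = right c
    ⟦ I ⟧ᵣ          = _≡ I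
    ⟦ X ⨟ Y ⟧ᵣ      = Image₂ _⨟_ ⟦ X ⟧ᵣ ⟦ Y ⟧ᵣ
    ⟦ X > Y ⟧ᵣ      = Image₂ _>_ ⟦ X ⟧ₗ ⟦ Y ⟧ᵣ
    ⟦ X < Y ⟧ᵣ      = Image₂ _<_ ⟦ X ⟧ᵣ ⟦ Y ⟧ₗ
    ⟦ x △̂[ j ] y ⟧ᵣ = ∅
    ⟦ x ▲̂[ j ] y ⟧ᵣ = ∅
    ⟦ x ▷̂[ j ] z ⟧ᵣ = Box ⟪_⟫˘ j ⟦ x ⟧ₗ ⟦ z ⟧ᵣ
    ⟦ x ▶̂[ j ] z ⟧ᵣ = Box ⟪_⟫ j ⟦ x ⟧ₗ ⟦ z ⟧ᵣ
    ⟦ z ◁̂[ j ] y ⟧ᵣ = Residual ⟪_⟫˘ j ⟦ z ⟧ᵣ ⟦ y ⟧ₗ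
    ⟦ z ◀̂[ j ] y ⟧ᵣ = Residual ⟪_⟫ j ⟦ z ⟧ᵣ ⟦ y ⟧ₗ

  -- Validity, uniqueness, adjunction and atoms.

  Valid : Structureᴰ t → Structureᴰ t → Set
  Valid {t} x y = ⟦ x ⟧ₗ ⊆ Below t ⟦ y ⟧ᵣ

  -- Virtual adjoints denote `∅` here, so only atomic actions remain. Balance and swap-in mention
  -- `F` twice, while the rules of D'.EAK need one and the same action.
  FNC-unique : ∀ (F : Structureᴰ FNC) {α β} → ⟦ F ⟧ₗ α → ⟦ F ⟧ₗ β → α ≡ β
  FNC-unique (↑ act _) refl refl = refl

  AG-unique : ∀ (𝐚 : Structureᴰ AG) {a b} → ⟦ 𝐚 ⟧ₗ a → ⟦ 𝐚 ⟧ₗ b → a ≡ b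
  AG-unique (↑ ag _) refl refl = refl

  -- At result type `FM` the adjunction is a display postulate of D'.EAK; at `i₃` it is residuation
  -- of plain sets. The index is split because `Below` and `Box` compute only on concrete types.
  box-intro : ∀ {l r o} q (j : Index l r o) {P : Pred (Carrier l) 0ℓ}
              {S : Pred (Carrier r) 0ℓ} {Q : Pred (Carrier o) 0ℓ} →
              Dia q j P S ⊆ Below o Q → S ⊆ Below r (Box q j P Q)
  box-intro q i₀ h s (img p y (modal i₀)) = disp↓ (q _) (h (img p s (modal i₀)) y)
  box-intro q i₁ h s (img p y (modal i₁)) = disp↓ (q _) (h (img p s (modal i₁)) y)
  box-intro q i₂ h s (img p y (modal i₂)) = disp↓ (q _) (h (img p s (modal i₂)) y)
  box-intro q i₃ h s p ρ                  = h (img p s ρ)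

  box-elim : ∀ {l r o} q (j : Index l r o) {P : Pred (Carrier l) 0ℓ}
             {S : Pred (Carrier r) 0ℓ} {Q : Pred (Carrier o) 0ℓ} →
             S ⊆ Below r (Box q j P Q) → Dia q j P S ⊆ Below o Q
  box-elim q i₀ h (img p s (modal i₀)) y = disp↑ (q _) (h s (img p y (modal i₀)))
  box-elim q i₁ h (img p s (modal i₁)) y = disp↑ (q _) (h s (img p y (modal i₁)))
  box-elim q i₂ h (img p s (modal i₂)) y = disp↑ (q _) (h s (img p y (modal i₂)))
  box-elim q i₃ h (img p s ρ)            = h s p ρ

  residual-intro : ∀ {l r o} q (j : Index l r o) {P : Pred (Carrier l) 0ℓ}
                   {S : Pred (Carrier r) 0ℓ} {Q : Pred (Carrier o) 0ℓ} →
                   Dia q j P S ⊆ Below o Q → P ⊆ Below l (Residual q j Q S)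
  residual-intro q i₀ h p s ρ = h (img p s ρ)
  residual-intro q i₁ h p s ρ = h (img p s ρ)
  residual-intro q i₂ h p s ρ = h (img p s ρ)
  residual-intro q i₃ h p s ρ = h (img p s ρ)

  residual-elim : ∀ {l r o} q (j : Index l r o) {P : Pred (Carrier l) 0ℓ}
                  {S : Pred (Carrier r) 0ℓ} {Q : Pred (Carrier o) 0ℓ} →
                  P ⊆ Below l (Residual q j Q S) → Dia q j P S ⊆ Below o Q
  residual-elim q i₀ h (img p s ρ) = h p s ρ
  residual-elim q i₁ h (img p s ρ) = h p s ρ
  residual-elim q i₂ h (img p s ρ) = h p s ρ
  residual-elim q i₃ h (img p s ρ) = h p s ρ

  ∈-left : (c : Term t) → generators c ⊆ left c
  ∈-left {t} c = ⊆-closure t (generators c)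

  left⊆ : (c : Term t) {Q : Pred (Carrier t) 0ℓ} →
          generators c ⊆ Below t Q → left c ⊆ Below t Q
  left⊆ {t} c {Q} = closure-least t (generators c) Q

  -- Each antecedent prefix is displayed into the succedent, where its converse lengthens the
  -- prefixed atom; the base case then holds by the choice of generators for `p`.
  prefixedₗ-sound : ∀ {p X x y} → Prefixedₗ p X → ⟦ X ⟧ₗ x → Prefixed p y → x ⊢ y
  prefixedₗ-sound atom     x f = x (λ x′ → x′ f)
  prefixedₗ-sound (△₀ F d) (img _ x (modal i₀)) f = dispₗ↑ (prefixedₗ-sound d x (bwd _ f))
  prefixedₗ-sound (▲₀ F d) (img _ x (modal i₀)) f = dispᵣ↓ (prefixedₗ-sound d x (fwd _ f))

  prefixedᵣ-sound : ∀ {p Y x y} → Prefixedᵣ p Y → Lower (Prefixed p) x → ⟦ Y ⟧ᵣ y → x ⊢ y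
  prefixedᵣ-sound atom     f y = y f
  prefixedᵣ-sound (▷₀ F d) f (img _ y (modal i₀)) =
    dispᵣ↑ (prefixedᵣ-sound d (λ z → dispᵣ↓ (f (fwd _ z))) y)
  prefixedᵣ-sound (▶₀ F d) f (img _ y (modal i₀)) =
    dispₗ↓ (prefixedᵣ-sound d (λ z → dispₗ↑ (f (bwd _ z))) y)

  -- Soundness of the Dynamic Calculus.

  sound : {x y : Structureᴰ t} → x ⊢ᴰ y → Valid x y

  -- Structural rules hold generator by generator: generators of the conclusion are taken apart,
  -- regrouped for the premise, and joined by the corresponding rule of D'.EAK.
  sound (prop (I<↓ d)) refl (img y x refl) = prop (I<↓ (sound d x y))
  sound (prop (I<↑ d)) x y = prop (I<↑ (sound d refl (img y x refl)))
  sound (prop (<I↓ d)) (img x y refl) refl = prop (<I↓ (sound d x y))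
  sound (prop (<I↑ d)) x y = prop (<I↑ (sound d (img x y refl) refl))
  sound (prop (I>↓ d)) refl (img x y refl) = prop (I>↓ (sound d x y))
  sound (prop (I>↑ d)) x y = prop (I>↑ (sound d refl (img x y refl)))
  sound (prop (>I↓ d)) (img y x refl) refl = prop (>I↓ (sound d x y))
  sound (prop (>I↑ d)) x y = prop (>I↑ (sound d (img y x refl) refl))
  sound (prop (I-weakₗ d)) _ x = prop (I-weakₗ (sound d refl x))
  sound (prop (I-weakᵣ d)) x _ = prop (I-weakᵣ (sound d x refl))
  sound (prop (weak<ᵣ d)) _ (img z x refl) = prop (weak<ᵣ (sound d x z))
  sound (prop (weak<ₗ d)) (img x z refl) _ = prop (weak<ₗ (sound d x z))
  sound (prop (weak>ᵣ d)) _ (img x z refl) = prop (weak>ᵣ (sound d x z))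
  sound (prop (weak>ₗ d)) (img z x refl) _ = prop (weak>ₗ (sound d x z))
  sound (prop (contrₗ d)) x y = prop (contrₗ (sound d (img x x refl) y))
  sound (prop (contrᵣ d)) y x = prop (contrᵣ (sound d y (img x x refl)))
  sound (prop (exchₗ d)) (img x y refl) z = prop (exchₗ (sound d (img y x refl) z))
  sound (prop (exchᵣ d)) z (img y x refl) = prop (exchᵣ (sound d z (img x y refl)))
  sound (prop (assocₗ d)) (img (img x y refl) z refl) w =
    prop (assocₗ (sound d (img x (img y z refl) refl) w))
  sound (prop (assocᵣ d)) w (img z (img y x refl) refl) =
    prop (assocᵣ (sound d w (img (img z y refl) x refl)))
  sound (prop (disp-⨟<↓ d)) x (img z y refl) = prop (disp-⨟<↓ (sound d (img x y refl) z))
  sound (prop (disp-⨟<↑ d)) (img x y refl) z = prop (disp-⨟<↑ (sound d x (img z y refl)))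
  sound (prop (disp-<⨟↓ d)) (img z y refl) x = prop (disp-<⨟↓ (sound d z (img x y refl)))
  sound (prop (disp-<⨟↑ d)) z (img x y refl) = prop (disp-<⨟↑ (sound d (img z y refl) x))
  sound (prop (disp-⨟>↓ d)) y (img x z refl) = prop (disp-⨟>↓ (sound d (img x y refl) z))
  sound (prop (disp-⨟>↑ d)) (img x y refl) z = prop (disp-⨟>↑ (sound d y (img x z refl)))
  sound (prop (disp->⨟↓ d)) (img x z refl) y = prop (disp->⨟↓ (sound d z (img x y refl)))
  sound (prop (disp->⨟↑ d)) z (img x y refl) = prop (disp->⨟↑ (sound d (img x z refl) y))
  sound (prop (grishinₗ↓ d)) (img (img x y refl) z refl) w =
    prop (grishinₗ↓ (sound d (img x (img y z refl) refl) w))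
  sound (prop (grishinₗ↑ d)) (img x (img y z refl) refl) w =
    prop (grishinₗ↑ (sound d (img (img x y refl) z refl) w))
  sound (prop (grishinᵣ↓ d)) w (img (img x y refl) z refl) =
    prop (grishinᵣ↓ (sound d w (img x (img y z refl) refl)))
  sound (prop (grishinᵣ↑ d)) w (img x (img y z refl) refl) =
    prop (grishinᵣ↑ (sound d w (img (img x y refl) z refl)))
  -- When the generators are `Lower Q`, the left set is a triple polar, and any member of `Q` lies
  -- in `Upper (Lower Q)`, so `x` may be tested on it. The left rules for `∨`, `⇒`, `⇐`, `▷` and `▶`
  -- work the same way.
  sound (prop ⊥ₗ) x refl = x (λ x′ → x′ refl)
  sound (prop (⊥ᵣ d)) x y = y (sound d x)
  sound (prop (⊤ₗ d)) = left⊆ ⊤ (sound d)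
  sound (prop ⊤ᵣ) = ∈-left ⊤
  sound (prop (∧ₗ {A} {B} d)) = left⊆ (A ∧ B) (sound d)
  sound (prop (∧ᵣ {A = A} {B = B} d e)) (img x y refl) =
    ∈-left (A ∧ B) (img (sound d x) (sound e y) refl)
  sound (prop (∨ₗ {A} {X} {B} {Y} d e)) x (img y z refl) =
    x (λ x′ → x′ (img (λ a → sound d (∈-left A a) y) (λ b → sound e (∈-left B b) z) refl))
  sound (prop (∨ᵣ d)) z w = w (sound d z)
  sound (prop (⇐ₗ {B = B} d e)) x (img y z refl) =
    x (λ x′ → x′ (img (λ b → sound d (∈-left B b) y) (sound e z) refl))
  sound (prop (⇐ᵣ d)) z w = w (sound d z)
  sound (prop (≺ₗ {B} {A} d)) = left⊆ (B ≺ A) (sound d)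
  sound (prop (≺ᵣ {B = B} {A = A} d e)) (img y x refl) =
    ∈-left (B ≺ A) (img (sound d y) (λ a → sound e (∈-left A a) x) refl)
  sound (prop (⇒ₗ {B = B} d e)) x (img y z refl) =
    x (λ x′ → x′ (img (sound d y) (λ b → sound e (∈-left B b) z) refl))
  sound (prop (⇒ᵣ d)) z w = w (sound d z)
  sound (prop (≻ₗ {A} {B} d)) = left⊆ (A ≻ B) (sound d)
  sound (prop (≻ᵣ {A = A} {B = B} d e)) (img x y refl) =
    ∈-left (A ≻ B) (img (λ a → sound d (∈-left A a) x) (sound e y) refl)

  sound (cut d e) x = sound e (sound d x)
  sound (ag a)  x = x
  sound (act α) x = x
  sound (atom ps qs) x y = prefixedᵣ-sound qs (prefixedₗ-sound ps x) y

  sound (△ₗ {c = c} {j = j} {d = d} e) = left⊆ (c △[ j ] d) (sound e)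
  sound (△ᵣ {c = c} {d = d} {j = j} e f) (img x y ρ) =
    ∈-left (c △[ j ] d) (img (sound e x) (sound f y) ρ)
  sound (▲ₗ {c = c} {j = j} {d = d} e) = left⊆ (c ▲[ j ] d) (sound e)
  sound (▲ᵣ {c = c} {d = d} {j = j} e f) (img x y ρ) =
    ∈-left (c ▲[ j ] d) (img (sound e x) (sound f y) ρ)
  sound (▷ₗ {B = B} d e) z (img x y ρ) =
    z (λ z′ → z′ (img (sound d x) (λ b → sound e (∈-left B b) y) ρ))
  sound (▷ᵣ d) z w = w (sound d z)
  sound (▶ₗ {B = B} d e) z (img x y ρ) =
    z (λ z′ → z′ (img (sound d x) (λ b → sound e (∈-left B b) y) ρ))
  sound (▶ᵣ d) z w = w (sound d z)

  sound (disp-△▶↓ {j = j} d) = box-intro ⟪_⟫ j (sound d)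
  sound (disp-△▶↑ {j = j} d) = box-elim ⟪_⟫ j (sound d)
  sound (disp-▲▷↓ {j = j} d) = box-intro ⟪_⟫˘ j (sound d)
  sound (disp-▲▷↑ {j = j} d) = box-elim ⟪_⟫˘ j (sound d)
  sound (disp-△◀↓ {j = j} d) = residual-intro ⟪_⟫ j (sound d)
  sound (disp-△◀↑ {j = j} d) = residual-elim ⟪_⟫ j (sound d)
  sound (disp-▲◁↓ {j = j} d) = residual-intro ⟪_⟫˘ j (sound d)
  sound (disp-▲◁↑ {j = j} d) = residual-elim ⟪_⟫˘ j (sound d)

  sound (nec-△ d) (img x refl (modal i)) w = necₗ (sound d refl w)
  sound (nec-▲ d) (img x refl (modal i)) w = necₗ (sound d refl w)
  sound (nec-▷ d) w (img x refl (modal i)) = necᵣ (sound d w refl)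
  sound (nec-▶ d) w (img x refl (modal i)) = necᵣ (sound d w refl)
  sound (conj-△ d) (img y (img x z (modal i)) refl) w =
    conj-exchₗ _ (sound d (img x (img (img x y (modal i)) z refl) (modal i)) w)
  sound (conj-▲ d) (img y (img x z (modal i)) refl) w =
    conj-exchₗ _ (sound d (img x (img (img x y (modal i)) z refl) (modal i)) w)
  sound (conj-▷ d) w (img y (img x z (modal i)) refl) =
    conj-exchᵣ _ (sound d w (img x (img (img x y (modal i)) z refl) (modal i)))
  sound (conj-▶ d) w (img y (img x z (modal i)) refl) =
    conj-exchᵣ _ (sound d w (img x (img (img x y (modal i)) z refl) (modal i)))
  sound (fs-△ d) (img x (img y z refl) (modal i)) w =
    fsₗ (sound d (img (img x y (modal i)) (img x z (modal i)) refl) w)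
  sound (fs-▲ d) (img x (img y z refl) (modal i)) w =
    fsₗ (sound d (img (img x y (modal i)) (img x z (modal i)) refl) w)
  sound (fs-▷ d) w (img x (img y z refl) (modal i)) =
    fsᵣ (sound d w (img (img x y (modal i)) (img x z (modal i)) refl))
  sound (fs-▶ d) w (img x (img y z refl) (modal i)) =
    fsᵣ (sound d w (img (img x y (modal i)) (img x z (modal i)) refl))
  sound (mon-△ d) (img x (img y z refl) (modal i)) w =
    monₗ (sound d (img (img x y (modal i)) (img x z (modal i)) refl) w)
  sound (mon-▲ d) (img x (img y z refl) (modal i)) w =
    monₗ (sound d (img (img x y (modal i)) (img x z (modal i)) refl) w)
  sound (mon-▷ d) w (img x (img y z refl) (modal i)) =
    monᵣ (sound d w (img (img x y (modal i)) (img x z (modal i)) refl))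
  sound (mon-▶ d) w (img x (img y z refl) (modal i)) =
    monᵣ (sound d w (img (img x y (modal i)) (img x z (modal i)) refl))

  -- Displaying exchanges the two EAK rules: an antecedent ▲ is the left adjoint
  -- of a succedent box, so the left DC rules rest on the right EAK rules.
  sound (swapOutₗ d) (img a (img f x (modal i₀)) (modal i₂)) y =
    dispᵣ↓ (dispᵣ↓ (contr-copiesₗ _ (swapOutᵣ λ β αaβ →
      dispᵣ↑ (dispᵣ↑ (sound d (img (img a f (step αaβ)) (img a x (modal i₂)) (modal i₁)) y)))))
  sound (swapOutᵣ d) x (img a (img f y (modal i₀)) (modal i₂)) =
    dispₗ↓ (dispₗ↓ (contr-copiesᵣ _ (swapOutₗ λ β αaβ →
      dispₗ↑ (dispₗ↑ (sound d x (img (img a f (step αaβ)) (img a y (modal i₂)) (modal i₁)))))))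
  sound (swapInₗ {𝐚 = 𝐚} {F = F} d)
        (img (img a f (step αaβ))
             (img a′ (img (img f′ refl (modal i₀)) x refl) (modal i₂)) (modal i₁)) y
    with refl ← FNC-unique F f f′ | refl ← AG-unique 𝐚 a a′ =
    -- The structure `F △̂[ i₀ ] I` contributes `⟪ act α ⟫ · I`; once it is displayed alone, `dom⇒Φ`
    -- trades it for the `Φ α` of `swapInᵣ`.
    dispᵣ↓ (dispᵣ↓ (prop (disp-⨟<↑ (dom⇒Φ (prop (disp-⨟<↓ (prop (disp-⨟>↑
      (swapInᵣ αaβ (dispᵣ↑ (dispᵣ↑ (sound d (img a (img f x (modal i₀)) (modal i₂)) y))))))))))))
  sound (swapInᵣ {𝐚 = 𝐚} {F = F} d) x
        (img (img a f (step αaβ))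
             (img a′ (img (img f′ refl (modal i₀)) y refl) (modal i₂)) (modal i₁))
    with refl ← FNC-unique F f f′ | refl ← AG-unique 𝐚 a a′ =
    dispₗ↓ (dispₗ↓ (prop (disp-⨟>↓ (prop (disp-⨟<↑ (dom⇒Φ (prop (disp-⨟<↓
      (swapInₗ αaβ (dispₗ↑ (dispₗ↑ (sound d x (img a (img f y (modal i₀)) (modal i₂))))))))))))))
  sound (balance {F = F} d) (img f x (modal i₀)) (img f′ y (modal i₀))
    with refl ← FNC-unique F f f′ = balance (sound d x y)

  -- Formulas inside the denotations of their translations.

  mutual

    -- The two halves are mutual because implications and subtractions switch sides. In each half,
    -- the operational rule of the main connective reduces the claim to generators built from the
    -- subformulas.
    ∈-left-′ : ∀ A → left (A ′) (↑ A)
    ∈-left-′ (` p)         y = y (atom atom)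
    ∈-left-′ ⊥             y = y (λ { refl → prop ⊥ₗ })
    ∈-left-′ ⊤             y = prop (⊤ₗ (y refl))
    ∈-left-′ (A ∧ B)       y = prop (∧ₗ (y (img (∈-left-′ A) (∈-left-′ B) refl)))
    ∈-left-′ (A ∨ B)       y = y λ { (img a b refl) → prop (∨ₗ (∈-left-′ A a) (∈-left-′ B b)) }
    ∈-left-′ (A ⇒ B)       y = y λ { (img a b refl) → prop (⇒ₗ (a (∈-right-′ A)) (∈-left-′ B b)) }
    ∈-left-′ (B ⇐ A)       y = y λ { (img b a refl) → prop (⇐ₗ (∈-left-′ B b) (a (∈-right-′ A))) }
    ∈-left-′ (A ≻ B)       y = prop (≻ₗ (y (img (∈-right-′ A) (∈-left-′ B) refl)))
    ∈-left-′ (B ≺ A)       y = prop (≺ₗ (y (img (∈-left-′ B) (∈-right-′ A) refl)))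
    ∈-left-′ (⟨ act _ ⟩ A) y = ⟨⟩ₗ (y (img refl (∈-left-′ A) (modal i₀)))
    ∈-left-′ (⟨ ag _ ⟩ A)  y = ⟨⟩ₗ (y (img refl (∈-left-′ A) (modal i₂)))
    ∈-left-′ ([ act _ ] A) y = y λ { (img refl a (modal i₀)) → []ₗ (∈-left-′ A a) }
    ∈-left-′ ([ ag _ ] A)  y = y λ { (img refl a (modal i₂)) → []ₗ (∈-left-′ A a) }
    ∈-left-′ (𝟏 _)         y = 𝟏ₗ (Φ⇒dom (y (img refl (λ z → z refl) (modal i₀))))

    ∈-right-′ : ∀ A → right (A ′) (↑ A)
    ∈-right-′ (` p)         x = x atom
    ∈-right-′ ⊥             x = prop (⊥ᵣ (x refl))
    ∈-right-′ ⊤             refl = prop ⊤ᵣ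
    ∈-right-′ (A ∧ B)       (img a b refl) = prop (∧ᵣ (a (∈-right-′ A)) (b (∈-right-′ B)))
    ∈-right-′ (A ∨ B)       x = prop (∨ᵣ (x (img (∈-right-′ A) (∈-right-′ B) refl)))
    ∈-right-′ (A ⇒ B)       x = prop (⇒ᵣ (x (img (∈-left-′ A) (∈-right-′ B) refl)))
    ∈-right-′ (B ⇐ A)       x = prop (⇐ᵣ (x (img (∈-right-′ B) (∈-left-′ A) refl)))
    ∈-right-′ (A ≻ B)       (img a b refl) = prop (≻ᵣ (∈-left-′ A a) (b (∈-right-′ B)))
    ∈-right-′ (B ≺ A)       (img b a refl) = prop (≺ᵣ (b (∈-right-′ B)) (∈-left-′ A a))
    ∈-right-′ (⟨ act _ ⟩ A) (img refl a (modal i₀)) = ⟨⟩ᵣ (a (∈-right-′ A))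
    ∈-right-′ (⟨ ag _ ⟩ A)  (img refl a (modal i₂)) = ⟨⟩ᵣ (a (∈-right-′ A))
    ∈-right-′ ([ act _ ] A) x = []ᵣ (x (img refl (∈-right-′ A) (modal i₀)))
    ∈-right-′ ([ ag _ ] A)  x = []ᵣ (x (img refl (∈-right-′ A) (modal i₂)))
    -- The generator is `⟪ act α ⟫ · X` with `X` in the closure of `I`, not just `I` itself; `dom⇒Φ`
    -- covers every `X`.
    ∈-right-′ (𝟏 _)         (img refl _ (modal i₀)) = dom⇒Φ 𝟏ᵣ

corollary7p6 : (𝓛 : Language) → let open Calculi 𝓛 in
    (A B : EAK.Formula) →
    (DC.↑ (A ′)) DC.⊢ (DC.↑ (B ′)) →
    (EAK.↑ A) EAK.⊢ (EAK.↑ B)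
corollary7p6 𝓛 A B d = sound d (∈-left-′ A) (∈-right-′ B)
  where open Semantics 𝓛
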